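{- For every positive integer $t$ and every finite graph $G$ of treewidth at most $t$, the hypergraph of balls in $G$ has a proper array sample compression scheme of size $4t+7$.
   Context: For a hypergraph $H$ (finite vertex set $V(H)$, hyperedges $E(H)\subseteq 2^{V(H)}$): a sample is a pair $(X^+,X^-)$ of subsets of $V(H)$ such that some hyperedge $e$ satisfies $X^+\subseteq e$ and $X^-\cap e=\emptyset$; $\mathcal{S}(H)$ is the set of samples; $S\subseteq V(H)$ realizes $(X^+,X^-)$ if $X^+\subseteq S$ and $S\cap X^-=\emptyset$. Let $\bot\notin V(H)$ be a fresh symbol. An array sample compression scheme of $H$ of size $k$ is a pair $(\kappa,\rho)$ with $\kappa:\mathcal{S}(H)\to(V(H)\cup\{\bot\})^k$ and $\rho:(V(H)\cup\{\bot\})^k\to 2^{V(H)}$ such that for every sample $(X^+,X^-)$, $\kappa(X^+,X^-)\in(X^+\cup X^-\cup\{\bot\})^k$ and $\rho(\kappa(X^+,X^-))$ realizes $(X^+,X^-)$. It is proper if all values of $\rho$ are in $E(H)$. For a graph $G$, $B_G(c,r)=\{v:\mathrm{dist}_G(c,v)\le r\}$ (shortest-path distance); the hypergraph of balls in $G$ has vertex set $V(G)$ and hyperedges all $B_G(c,r)$, $c\in V(G)$, $r$ an integer. Treewidth is the usual minimum width of a tree decomposition. -}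

module Defs where

open import Data.Fin.Base using (Fin)
open import Data.Fin.Subset using (Subset; _∈_; _⊆_; _∩_; _∪_; Empty; ∣_∣)
open import Data.Integer.Base as ℤ using (ℤ; +_)
open import Data.List.Base using (List; _∷_; _∷ʳ_; length)
open import Data.List.Relation.Unary.Linked using (Linked)
open import Data.List.Relation.Unary.Unique.Propositional using (Unique)
open import Data.Maybe.Base using (Maybe)
import Data.Maybe.Relation.Unary.All as Maybe
open import Data.Nat.Base using (ℕ; zero; suc; _∸_; _⊔_; _≤_; NonZero)
open import Data.Product.Base using (Σ-syntax; ∃; ∃-syntax; _×_)
open import Data.Vec.Base using (Vec)
import Data.Vec.Functional as Fun
import Data.Vec.Relation.Unary.All as Vec
open import Function.Bundles using (_⇔_)
open import Level using (0ℓ)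
open import Relation.Binary.Core using (Rel)
open import Relation.Binary.Definitions using (Decidable; Irreflexive; Symmetric)
open import Relation.Binary.PropositionalEquality.Core using (_≡_)
open import Relation.Nullary.Negation.Core using (¬_)
open import Relation.Unary using (Pred)

-- Since `Subset n` is a type of Boolean vectors, a predicate on it is a
-- set of subsets, with no extensionality issue.
record Hypergraph (n : ℕ) : Set₁ where
  field
    IsEdge : Pred (Subset n) 0ℓ

open Hypergraph public

Realizes : ∀ {n} → Subset n → Subset n → Subset n → Set
Realizes S X⁺ X⁻ = X⁺ ⊆ S × Empty (S ∩ X⁻)

-- The hyperedge witnessing that the pair is a sample is irrelevant, so
-- that functions on samples depend on the pair only.
record Sample {n} (H : Hypergraph n) : Set where
  constructor sample
  field
    X⁺ X⁻   : Subset n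
    .traced : ∃[ e ] IsEdge H e × X⁺ ⊆ e × Empty (X⁻ ∩ e)

-- `nothing` plays the role of the fresh symbol ⊥.
record ArrayCompressionScheme {n} (H : Hypergraph n) (k : ℕ) : Set where
  open Sample
  field
    κ : Sample H → Vec (Maybe (Fin n)) k
    ρ : Vec (Maybe (Fin n)) k → Subset n
    κ-within   : ∀ s → Vec.All (Maybe.All (_∈ X⁺ s ∪ X⁻ s)) (κ s)
    ρ-realizes : ∀ s → Realizes (ρ (κ s)) (X⁺ s) (X⁻ s)

Proper : ∀ {n k} {H : Hypergraph n} → ArrayCompressionScheme H k → Set
Proper {H = H} C = ∀ a → IsEdge H (ArrayCompressionScheme.ρ C a)

record Graph (n : ℕ) : Set₁ where
  field
    Adj    : Rel (Fin n) 0ℓ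
    adj?   : Decidable Adj
    sym    : Symmetric Adj
    irrefl : Irreflexive _≡_ Adj

open Graph public

data Walk {V : Set} (R : Rel V 0ℓ) : V → V → ℕ → Set where
  []  : ∀ {u} → Walk R u u zero
  _∷_ : ∀ {u v w ℓ} → R u v → Walk R v w ℓ → Walk R u w (suc ℓ)

-- Vertices in different components are at no distance d (i.e. at infinite
-- distance).
IsDist : ∀ {n} → Graph n → Fin n → Fin n → ℕ → Set
IsDist G u v d = Walk (Adj G) u v d × (∀ {ℓ} → Walk (Adj G) u v ℓ → d ≤ ℓ)

InBall : ∀ {n} → Graph n → Fin n → ℤ → Pred (Fin n) 0ℓ
InBall G c r v = ∃[ d ] IsDist G c v d × (+ d) ℤ.≤ r

balls : ∀ {n} → Graph n → Hypergraph n
balls G .IsEdge S = ∃[ c ] ∃[ r ] (∀ v → v ∈ S ⇔ InBall G c r v)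

Connected : ∀ {n} → Graph n → Set
Connected G = ∀ u v → ∃[ ℓ ] Walk (Adj G) u v ℓ

IsCycle : ∀ {n} → Graph n → Fin n → List (Fin n) → Set
IsCycle G x xs =
  2 ≤ length xs × Unique (x ∷ xs) × Linked (Adj G) (x ∷ xs ∷ʳ x)

record IsTree {m} (T : Graph m) : Set where
  field
    nonEmpty  : NonZero m
    connected : Connected T
    acyclic   : ∀ x xs → ¬ IsCycle T x xs

record TreeDecomposition {n} (G : Graph n) : Set₁ where
  field
    {m}    : ℕ
    T      : Graph m
    isTree : IsTree T
    bag    : Fin m → Subset n

  -- Adjacency in the subgraph of T induced by the nodes whose bag contains v.
  AdjAt : Fin n → Rel (Fin m) 0ℓ
  AdjAt v i j = v ∈ bag i × v ∈ bag j × Adj T i j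

  field
    coversVertices : ∀ v → ∃[ i ] v ∈ bag i
    coversEdges    : ∀ {u v} → Adj G u v → ∃[ i ] u ∈ bag i × v ∈ bag i
    connectedAt    : ∀ v {i j} → v ∈ bag i → v ∈ bag j →
                     ∃[ ℓ ] Walk (AdjAt v) i j ℓ

  width : ℕ
  width = Fun.foldr _⊔_ 0 (λ i → ∣ bag i ∣) ∸ 1

-- For a graph with at least one vertex some bag is nonempty, so the
-- truncated subtraction in `width` is harmless.
IsTreewidth : ∀ {n} → Graph n → ℕ → Set₁
IsTreewidth G w =
  (Σ[ D ∈ TreeDecomposition G ] width D ≡ w) ×
  (∀ (D : TreeDecomposition G) → w ≤ width D)
  where open TreeDecomposition

{-# OPTIONS --safe #-}
module Submission where

-- Root the tree of a decomposition and attach every vertex of G to a node whose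
-- bag contains it. Let Z be the closure under lowest common ancestors of the
-- root and the nodes of the sample points, and let c be the centre of a ball
-- realizing the sample. The part of the tree around the node of c left after
-- removing Z touches at most two nodes of Z, and both are named by at most
-- three sample points: z₁ = lca x₁ x₂ and its predecessor z = lca x₁ x₃. So the
-- at most 2(t + 1) vertices b of their two bags separate c from the sample, and
-- dist c x is the minimum of dist c b + dist b x. Storing for each b the
-- farthest positive point reached through b inside the ball, and the negative
-- point nearest to b, forces every ball centred in the same region and
-- consistent with these bounds to realize the sample, which makes
-- 3 + 4(t + 1) entries. If the region touches only one node z of Z, it may be
-- one of many subtrees hanging at z; then the entries saved on the second bag
-- hold two sample points whose subtrees delimit it.

import Data.Bool.Base as Bool
open import Data.Empty using (⊥-elim)
open import Data.Fin.Base as Fin using (Fin; zero; suc; toℕ)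
import Data.Fin.Properties as Fin
open import Data.Fin.Subset using (Subset; inside; outside; ∣_∣; _∈_; _⊆_; _∩_; _∪_; Empty)
import Data.Fin.Subset.Properties as Subset
open import Data.Integer.Base using (+_; -[1+_]; +≤+)
open import Data.List.Base as List using (List; []; _∷_; _∷ʳ_; length)
open import Data.List.Membership.Propositional using () renaming (_∈_ to _∈ˡ_)
import Data.List.Membership.DecPropositional as DecMembership
open import Data.List.Membership.Propositional.Properties using (∈-lookup; ∈-map⁺)
open import Data.List.Properties using (length-map)
open import Data.List.Relation.Unary.All as All using (All; []; _∷_)
open import Data.List.Relation.Unary.All.Properties using (¬Any⇒All¬)
open import Data.List.Relation.Unary.AllPairs using ([]; _∷_)
open import Data.List.Relation.Unary.Any using (here; there)
open import Data.List.Relation.Unary.Linked using (Linked; [-]; _∷_)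
open import Data.List.Relation.Unary.Unique.Propositional using (Unique)
open import Data.Maybe.Base using (Maybe; just; nothing)
open import Data.Maybe.Relation.Unary.All as Maybe using (just; nothing)
open import Data.Maybe.Relation.Unary.Any as MaybeAny using (just)
open import Data.Nat.Base
open import Data.Nat.Properties
open import Data.Nat.Tactic.RingSolver using (solve-∀)
open import Data.Product.Base
open import Data.Sum.Base as Sum using (_⊎_; inj₁; inj₂)
open import Data.Vec.Base as Vec using (Vec; []; _∷_; _++_; here; there)
import Data.Vec.Functional as Fun
open import Data.Vec.Membership.Propositional using () renaming (_∈_ to _∈ᵛ_)
open import Data.Vec.Membership.Propositional.Properties using (∈-++⁺ˡ; ∈-++⁺ʳ)
import Data.Vec.Properties as Vec
open import Data.Vec.Relation.Unary.All using ([]; _∷_) renaming (All to Allᵛ)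
import Data.Vec.Relation.Unary.All.Properties as Allᵛ
import Data.Vec.Relation.Unary.Any.Properties as AnyᵛP
open import Data.Vec.Relation.Unary.Any as Anyᵛ using (here; there)
open import Function.Base using (_∘_; flip; _on_)
open import Function.Bundles using (_⇔_; mk⇔; Equivalence)
open import Level using (Level; 0ℓ)
open import Relation.Binary.Core using (Rel)
import Relation.Binary.Definitions as B
open import Relation.Binary.PropositionalEquality.Core
  using (_≡_; _≢_; refl; sym; trans; cong; subst)
open import Relation.Nullary
open import Relation.Nullary.Decidable using (map′; dec-true; _×-dec_; _⊎-dec_; _→-dec_)
open import Relation.Unary using (Pred; Decidable)

open import Defs hiding (sym)

private
  variable
    ℓ ℓ′ : Level
    m n : ℕ

-- Extremal elements of finite sets

extremum : ∀ {P : Pred (Fin m) ℓ} {_⊑_ : Rel (Fin m) ℓ′} →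
  B.Total _⊑_ → B.Transitive _⊑_ → Decidable P →
  (∃[ i ] P i × (∀ j → P j → j ⊑ i)) ⊎ (∀ j → ¬ P j)
extremum {zero} total trans P? = inj₂ λ ()
extremum {suc m} {P = P} {_⊑_} total trans P?
  with P? zero
     | extremum {P = P ∘ suc} {_⊑_ on suc} (λ i j → total (suc i) (suc j)) trans (P? ∘ suc)
... | no ¬p | inj₂ none = inj₂ λ { zero → ¬p ; (suc j) → none j }
... | no ¬p | inj₁ (i , pᵢ , best) =
  inj₁ (suc i , pᵢ , λ { zero p → ⊥-elim (¬p p) ; (suc j) → best j })
... | yes p | inj₂ none =
  inj₁ (zero , p , λ { zero _ → Sum.reduce (total zero zero) ; (suc j) pⱼ → ⊥-elim (none j pⱼ) })
... | yes p | inj₁ (i , pᵢ , best) with total zero (suc i)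
...   | inj₁ 0⊑i = inj₁ (suc i , pᵢ , λ { zero _ → 0⊑i ; (suc j) → best j })
...   | inj₂ i⊑0 =
  inj₁ (zero , p , λ { zero _ → Sum.reduce (total zero zero)
                     ; (suc j) pⱼ → trans (best j pⱼ) i⊑0 })

argmax : ∀ {P : Pred (Fin m) ℓ} → Decidable P → (f : Fin m → ℕ) →
  (∃[ i ] P i × (∀ j → P j → f j ≤ f i)) ⊎ (∀ j → ¬ P j)
argmax P? f = extremum (λ i j → ≤-total (f i) (f j)) ≤-trans P?

argmin : ∀ {P : Pred (Fin m) ℓ} → Decidable P → (f : Fin m → ℕ) →
  (∃[ i ] P i × (∀ j → P j → f i ≤ f j)) ⊎ (∀ j → ¬ P j)
argmin P? f = extremum (λ i j → ≤-total (f j) (f i)) (flip ≤-trans) P?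

-- The default value `N` means that `P` fails everywhere below `N`; in the definition of `dist` it
-- becomes the infinite distance.
least : ∀ {P : Pred ℕ ℓ} → Decidable P → ∀ N →
  ∃[ d ] d ≤ N × (d < N → P d) × (∀ {k} → P k → k < N → d ≤ k)
least P? zero = 0 , z≤n , (λ ()) , λ _ _ → z≤n
least P? (suc N) with P? 0 | least (P? ∘ suc) N
... | yes p | _ = 0 , z≤n , (λ _ → p) , λ _ _ → z≤n
... | no ¬p | d , d≤N , p , min =
  suc d , s≤s d≤N , p ∘ s≤s⁻¹ ,
  λ { {zero} p₀ _ → ⊥-elim (¬p p₀) ; {suc k} pₖ k<N → s≤s (min pₖ (s≤s⁻¹ k<N)) }

-- Walks

module _ {V : Set} {R : Rel V 0ℓ} where

  infixr 5 _++ʷ_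

  _++ʷ_ : ∀ {u v w k l} → Walk R u v k → Walk R v w l → Walk R u w (k + l)
  []      ++ʷ q = q
  (r ∷ p) ++ʷ q = r ∷ (p ++ʷ q)

  snocʷ : ∀ {u v w l} → Walk R u v l → R v w → Walk R u w (suc l)
  snocʷ []      s = s ∷ []
  snocʷ (r ∷ p) s = r ∷ snocʷ p s

  reverseʷ : B.Symmetric R → ∀ {u v l} → Walk R u v l → Walk R v u l
  reverseʷ R-sym []      = []
  reverseʷ R-sym (r ∷ p) = snocʷ (reverseʷ R-sym p) (R-sym r)

  verts : ∀ {u v l} → Walk R u v l → List V
  verts {u} []      = u ∷ []
  verts {u} (_ ∷ p) = u ∷ verts p

  length-verts : ∀ {u v l} (p : Walk R u v l) → length (verts p) ≡ suc l
  length-verts []      = refl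
  length-verts (_ ∷ p) = cong suc (length-verts p)

  Simple : ∀ {u v l} → Walk R u v l → Set
  Simple p = Unique (verts p)

  simple-suffix : ∀ {u v x l} (p : Walk R u v l) → Simple p → x ∈ˡ verts p →
    ∃[ l′ ] Σ[ q ∈ Walk R x v l′ ] Simple q
  simple-suffix []      s       (here refl) = _ , [] , s
  simple-suffix (r ∷ p) s       (here refl) = _ , r ∷ p , s
  simple-suffix (r ∷ p) (_ ∷ s) (there x∈p) = simple-suffix p s x∈p

  -- If the new first vertex already occurs on the simplified tail, the loop is cut off by starting
  -- at that occurrence.
  simplify : B.DecidableEquality V → ∀ {u v l} → Walk R u v l →
    ∃[ l′ ] Σ[ q ∈ Walk R u v l′ ] Simple q
  simplify _≟_ []          = _ , [] , [] ∷ []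
  simplify _≟_ {u} (r ∷ p) with simplify _≟_ p
  ... | _ , q , s with DecMembership._∈?_ _≟_ u (verts q)
  ...   | yes u∈q = simple-suffix q s u∈q
  ...   | no  u∉q = _ , r ∷ q , ¬Any⇒All¬ _ u∉q ∷ s

unique⇒length≤ : {xs : List (Fin n)} → Unique xs → length xs ≤ n
unique⇒length≤ u = Fin.injective⇒≤ (lookup-injective u)
  where
  lookup-injective : ∀ {xs : List (Fin n)} → Unique xs →
    ∀ {i j} → List.lookup xs i ≡ List.lookup xs j → i ≡ j
  lookup-injective (_ ∷ _)  {zero}  {zero}  _  = refl
  lookup-injective (x≢ ∷ _) {zero}  {suc j} eq = ⊥-elim (All.lookup x≢ (∈-lookup j) eq)
  lookup-injective (x≢ ∷ _) {suc i} {zero}  eq = ⊥-elim (All.lookup x≢ (∈-lookup i) (sym eq))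
  lookup-injective (_ ∷ u)  {suc i} {suc j} eq = cong suc (lookup-injective u eq)

walk-shorten : ∀ {R : Rel (Fin n) 0ℓ} {u v l} → Walk R u v l → ∃[ l′ ] l′ < n × Walk R u v l′
walk-shorten p with simplify Fin._≟_ p
... | l′ , q , s = l′ , subst (_≤ _) (length-verts q) (unique⇒length≤ s) , q

-- Graph distance

walk? : ∀ {R : Rel (Fin n) 0ℓ} → B.Decidable R → ∀ u v l → Dec (Walk R u v l)
walk? R? u v zero    = map′ (λ { refl → [] }) (λ { [] → refl }) (u Fin.≟ v)
walk? R? u v (suc l) =
  map′ (λ { (_ , r , p) → r ∷ p }) (λ { (r ∷ p) → _ , r , p })
       (Fin.any? λ w → R? u w ×-dec walk? R? w v l)

module Distance {n} (G : Graph n) where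

  private
    dist-spec : ∀ u v → _
    dist-spec u v = least (walk? (adj? G) u v) n

  opaque
    -- The distance n, one more than any finite distance, stands for infinity.
    dist : Fin n → Fin n → ℕ
    dist u v = proj₁ (dist-spec u v)

    dist≤n : ∀ u v → dist u v ≤ n
    dist≤n u v = proj₁ (proj₂ (dist-spec u v))

    dist-walk : ∀ {u v} → dist u v < n → Walk (Adj G) u v (dist u v)
    dist-walk {u} {v} = proj₁ (proj₂ (proj₂ (dist-spec u v)))

    private
      dist-min : ∀ {u v l} → Walk (Adj G) u v l → l < n → dist u v ≤ l
      dist-min {u} {v} = proj₂ (proj₂ (proj₂ (dist-spec u v)))

  dist≤walk : ∀ {u v l} → Walk (Adj G) u v l → dist u v ≤ l
  dist≤walk {u} {v} {l} p with l <? n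
  ... | yes l<n = dist-min p l<n
  ... | no  l≮n = ≤-trans (dist≤n u v) (≮⇒≥ l≮n)

  dist-finite : ∀ {u v l} → Walk (Adj G) u v l → dist u v < n
  dist-finite p with walk-shorten p
  ... | _ , l′<n , q = ≤-<-trans (dist-min q l′<n) l′<n

  dist-triangle : ∀ u v w → dist u w ≤ dist u v + dist v w
  dist-triangle u v w with dist u v <? n | dist v w <? n
  ... | yes p | yes q = dist≤walk (dist-walk p ++ʷ dist-walk q)
  -- An infinite summand is at least `n`, which bounds every distance.
  ... | no ¬p | _     = ≤-trans (dist≤n u w) (≤-trans (≮⇒≥ ¬p) (m≤m+n _ _))
  ... | _     | no ¬q = ≤-trans (dist≤n u w) (≤-trans (≮⇒≥ ¬q) (m≤n+m _ _))

-- Rooted trees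

record RootedTree (m : ℕ) : Set₁ where
  field
    root          : Fin m
    depth         : Fin m → ℕ
    Parent        : Rel (Fin m) 0ℓ
    parent?       : B.Decidable Parent
    parent-depth  : ∀ {a i} → Parent a i → suc (depth a) ≡ depth i
    parent-unique : ∀ {a b i} → Parent a i → Parent b i → a ≡ b
    root-or-child : ∀ i → i ≡ root ⊎ ∃[ a ] Parent a i
    depth-root    : depth root ≡ 0

-- Each non-root node of a tree has exactly one neighbour a that is not
-- farther from the root: another one, j, could be joined to a through the
-- root by a walk avoiding the node, which would close a cycle.
module Rooting {m} (T : Graph m) (isTree : IsTree T) where
  open Distance T
  open IsTree isTree

  root : Fin m
  root = choose nonEmpty
    where
    choose : ∀ {m} → NonZero m → Fin m
    choose {suc m} _ = zero

  depth : Fin m → ℕ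
  depth i = dist i root

  geodesic : ∀ i → Walk (Adj T) i root (depth i)
  geodesic i = dist-walk (dist-finite (proj₂ (connected i root)))

  Avoiding : Fin m → Rel (Fin m) 0ℓ
  Avoiding i u v = u ≢ i × v ≢ i × Adj T u v

  avoiding-sym : ∀ {i} → B.Symmetric (Avoiding i)
  avoiding-sym (u≢i , v≢i , a) = v≢i , u≢i , Graph.sym T a

  depth<⇒≢ : ∀ {i u l} → Walk (Adj T) u root l → l < depth i → u ≢ i
  depth<⇒≢ p l<d refl = <⇒≱ l<d (dist≤walk p)

  -- After its first step, a walk to the root of length at most `depth i` is too short to pass
  -- through `i`.
  avoid : ∀ {i u l} → u ≢ i → Walk (Adj T) u root l → l ≤ depth i →
    Walk (Avoiding i) u root l
  avoid u≢i []      _  = []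
  avoid u≢i (a ∷ p) l≤ = (u≢i , v≢i , a) ∷ avoid v≢i p (<⇒≤ l≤)
    where v≢i = depth<⇒≢ p l≤

  -- If the simplified walk has a step, it has at least two vertices, none of them `i`, and adding
  -- `i` closes a cycle.
  no-bypass : ∀ {i a j l} → Adj T i a → Adj T i j → Walk (Avoiding i) a j l → a ≡ j
  no-bypass {i} {a} {j} ia ij p with simplify Fin._≟_ p
  ... | _ , []            , s = refl
  ... | _ , q@(r ∷ p′) , s =
    ⊥-elim (acyclic i (verts q)
      ( subst (2 ≤_) (sym (length-verts q)) (s≤s (s≤s z≤n))
      , avoided q (proj₁ r) ∷ s
      , closed q ia ))
    where
    avoided : ∀ {u v l} (w : Walk (Avoiding i) u v l) → u ≢ i → All (i ≢_) (verts w)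
    avoided []      u≢i = (u≢i ∘ sym) ∷ []
    avoided (r ∷ w) u≢i = (u≢i ∘ sym) ∷ avoided w (proj₁ (proj₂ r))

    closed : ∀ {x u l} (w : Walk (Avoiding i) u j l) → Adj T x u →
      Linked (Adj T) (x ∷ verts w ∷ʳ i)
    closed []      xu = xu ∷ Graph.sym T ij ∷ [-]
    closed (r ∷ w) xu = xu ∷ closed w (proj₂ (proj₂ r))

  Parent : Rel (Fin m) 0ℓ
  Parent a i = Adj T i a × suc (depth a) ≡ depth i

  lower-neighbour-unique : ∀ {i a j} → Adj T i a → depth a ≤ depth i →
    Adj T i j → depth j ≤ depth i → a ≡ j
  lower-neighbour-unique ia a≤ ij j≤ = no-bypass ia ij
    (avoid (≢-of ia) (geodesic _) a≤ ++ʷ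
     reverseʷ avoiding-sym (avoid (≢-of ij) (geodesic _) j≤))
    where
    ≢-of : ∀ {i j} → Adj T i j → j ≢ i
    ≢-of ij refl = irrefl T refl ij

  parent-exists : ∀ i → i ≡ root ⊎ ∃[ a ] Parent a i
  parent-exists i with depth i in eq | geodesic i
  ... | zero  | []    = inj₁ refl
  ... | suc d | a ∷ p = inj₂ (_ , a , ≤-antisym
    (s≤s (dist≤walk p))
    (≤-trans (≤-reflexive (sym eq)) (dist≤walk (a ∷ geodesic _))))

  -- The endpoint that is not deeper is a lower neighbour of the other, hence its parent by
  -- uniqueness. The root has no such neighbour, since it alone has depth zero.
  edge⇒parent : ∀ {i j} → Adj T i j → Parent i j ⊎ Parent j i
  edge⇒parent {i} {j} ij with depth j ≤? depth i
  ... | yes j≤i with parent-exists i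
  ...   | inj₂ (a , ia , d) = inj₂ (subst (λ x → Parent x i)
            (lower-neighbour-unique ia (≤-trans (n≤1+n _) (≤-reflexive d)) ij j≤i) (ia , d))
  edge⇒parent {i} {j} ij | yes j≤i | inj₁ refl = ⊥-elim (irrefl T (sym j≡r) ij)
    where
    zero-walk : ∀ {u v l} → Walk (Adj T) u v l → l ≤ 0 → u ≡ v
    zero-walk [] _ = refl
    j≡r = zero-walk (geodesic j) (≤-trans j≤i (dist≤walk []))
  edge⇒parent {i} {j} ij | no j≰i with parent-exists j
  ... | inj₂ (a , ja , d) = inj₁ (subst (λ x → Parent x j)
          (lower-neighbour-unique ja (≤-trans (n≤1+n _) (≤-reflexive d))
            (Graph.sym T ij) (<⇒≤ (≰⇒> j≰i))) (ja , d))
  ... | inj₁ refl = ⊥-elim (j≰i (≤-trans (dist≤walk []) z≤n))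

  rooted : RootedTree m
  rooted = record
    { root          = root
    ; depth         = depth
    ; Parent        = Parent
    ; parent?       = λ a i → adj? T i a ×-dec (suc (depth a) ≟ depth i)
    ; parent-depth  = proj₂
    ; parent-unique = λ (ia , a) (ib , b) → lower-neighbour-unique
        ia (≤-trans (n≤1+n _) (≤-reflexive a)) ib (≤-trans (n≤1+n _) (≤-reflexive b))
    ; root-or-child = parent-exists
    ; depth-root    = n≤0⇒n≡0 (dist≤walk [])
    }

module RootedTreeProperties {m} (t : RootedTree m) where
  open RootedTree t public

  infix 4 _≼_ _≼?_

  data _≼_ (a : Fin m) : Fin m → Set where
    ≼-refl : a ≼ a
    up     : ∀ {b i} → a ≼ b → Parent b i → a ≼ i

  parent-≼ : ∀ {a i} → Parent a i → a ≼ i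
  parent-≼ = up ≼-refl

  ≼-trans : ∀ {a b c} → a ≼ b → b ≼ c → a ≼ c
  ≼-trans p ≼-refl   = p
  ≼-trans p (up q r) = up (≼-trans p q) r

  parent-< : ∀ {a i} → Parent a i → depth a < depth i
  parent-< = ≤-reflexive ∘ parent-depth

  ≼⇒≤ : ∀ {a b} → a ≼ b → depth a ≤ depth b
  ≼⇒≤ ≼-refl   = ≤-refl
  ≼⇒≤ (up p r) = ≤-trans (≼⇒≤ p) (<⇒≤ (parent-< r))

  ≼-≥⇒≡ : ∀ {a b} → a ≼ b → depth b ≤ depth a → a ≡ b
  ≼-≥⇒≡ ≼-refl   _ = refl
  ≼-≥⇒≡ (up p r) d = ⊥-elim (<⇒≱ (≤-<-trans (≼⇒≤ p) (parent-< r)) d)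

  ≼-strict : ∀ {a b} → a ≼ b → a ≢ b → depth a < depth b
  ≼-strict p a≢b = ≰⇒> (a≢b ∘ ≼-≥⇒≡ p)

  ≼-pred : ∀ {a b i} → a ≼ i → a ≢ i → Parent b i → a ≼ b
  ≼-pred ≼-refl   a≢i _ = ⊥-elim (a≢i refl)
  ≼-pred (up p s) a≢i r with refl ← parent-unique r s = p

  -- On the climb from `i` to `b`, every node left behind is deeper than `b`, hence different from
  -- `a`, so `a` remains an ancestor of the next node.
  ≼-chain : ∀ {a b i} → a ≼ i → b ≼ i → depth a ≤ depth b → a ≼ b
  ≼-chain p ≼-refl   _ = p
  ≼-chain p (up q r) d = ≼-chain (≼-pred p a≢i r) q d
    where
    a≢i : _ ≢ _
    a≢i refl = <⇒≱ (≤-<-trans (≼⇒≤ q) (parent-< r)) d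

  private
    by-depth : ∀ d i → depth i ≡ d →
      (root ≼ i) × (∀ a → Dec (a ≼ i))
    by-depth d i eq with root-or-child i
    by-depth d i eq | inj₁ refl = ≼-refl , λ a →
      map′ (λ { refl → ≼-refl })
           (λ p → ≼-≥⇒≡ p (≤-trans (≤-reflexive depth-root) z≤n))
           (a Fin.≟ root)
    by-depth zero    i eq | inj₂ (b , r) = ⊥-elim (1+n≢0 (trans (parent-depth r) eq))
    by-depth (suc d) i eq | inj₂ (b , r)
      with root≼b , dec ← by-depth d b (suc-injective (trans (parent-depth r) eq)) =
      up root≼b r , λ a → ancestor? a (a Fin.≟ i) (dec a)
      where
      ancestor? : ∀ a → Dec (a ≡ i) → Dec (a ≼ b) → Dec (a ≼ i)
      ancestor? a (yes refl) _       = yes ≼-refl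
      ancestor? a (no _)     (yes p) = yes (up p r)
      ancestor? a (no a≢i)   (no ¬p) = no λ q → ¬p (≼-pred q a≢i r)

  root≼ : ∀ i → root ≼ i
  root≼ i = proj₁ (by-depth _ i refl)

  _≼?_ : B.Decidable _≼_
  a ≼? i = proj₂ (by-depth _ i refl) a

  private
    common-ancestor : ∀ i j → ∃[ z ] (z ≼ i × z ≼ j) × (∀ w → w ≼ i × w ≼ j → depth w ≤ depth z)
    common-ancestor i j with argmax (λ z → z ≼? i ×-dec z ≼? j) depth
    ... | inj₁ z    = z
    ... | inj₂ none = ⊥-elim (none root (root≼ i , root≼ j))

  opaque
    lca : Fin m → Fin m → Fin m
    lca i j = proj₁ (common-ancestor i j)

    lca-≼ˡ : ∀ i j → lca i j ≼ i
    lca-≼ˡ i j = proj₁ (proj₁ (proj₂ (common-ancestor i j)))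

    lca-≼ʳ : ∀ i j → lca i j ≼ j
    lca-≼ʳ i j = proj₂ (proj₁ (proj₂ (common-ancestor i j)))

    lca-greatest : ∀ {w i j} → w ≼ i → w ≼ j → w ≼ lca i j
    lca-greatest {w} {i} {j} p q = ≼-chain p (lca-≼ˡ i j)
      (proj₂ (proj₂ (common-ancestor i j)) w (p , q))

  -- Regions of the tree and their boundaries

  Cut : Pred (Fin m) 0ℓ → Pred (Fin m) 0ℓ → Set
  Cut R Z = ∀ {i j} → R i → Parent i j ⊎ Parent j i → Z i ⊎ R j ⊎ Z j

  -- The part of the tree strictly below z on the side of x, without what is
  -- strictly below z₁.
  Between : (z x z₁ : Fin m) → Pred (Fin m) 0ℓ
  Between z x z₁ i = depth z < depth (lca x i) × (z₁ ≼ i → z₁ ≡ i)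

  -- A step down from `i ≢ z₁` keeps `lca x i` as a common ancestor with `x` and cannot land
  -- strictly below `z₁`. A step up leaves the region only by reaching `z`. Since `z₁` may belong to
  -- the region, on the way down the boundary is met at the near end of the edge.
  between-cut : ∀ {z x z₁} → z ≼ x → Cut (Between z x z₁) (λ i → i ≡ z ⊎ i ≡ z₁)
  between-cut {z} {x} {z₁} z≼x {i} {j} (d , below) (inj₁ ij) with i Fin.≟ z₁
  ... | yes i≡z₁ = inj₁ (inj₂ i≡z₁)
  ... | no  i≢z₁ = inj₂ (inj₁
    ( <-≤-trans d (≼⇒≤ (lca-greatest (lca-≼ˡ x i) (up (lca-≼ʳ x i) ij)))
    , below-j ))
    where
    below-j : z₁ ≼ j → z₁ ≡ j
    below-j p with z₁ Fin.≟ j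
    ... | yes eq = eq
    ... | no neq = ⊥-elim (i≢z₁ (sym (below (≼-pred p neq ij))))
  between-cut {z} {x} {z₁} z≼x {i} {j} (d , below) (inj₂ ji) with j Fin.≟ z
  ... | yes j≡z = inj₂ (inj₂ (inj₁ j≡z))
  ... | no  j≢z = inj₂ (inj₁ (deeper , λ p → ⊥-elim (not-below p (below (up p ji)))))
    where
    not-below : z₁ ≼ j → z₁ ≢ i
    not-below p refl = <⇒≱ (parent-< ji) (≼⇒≤ p)

    z≼i : z ≼ i
    z≼i = ≼-trans (≼-chain z≼x (lca-≼ˡ x i) (<⇒≤ d)) (lca-≼ʳ x i)

    z≢i : z ≢ i
    z≢i refl = <⇒≱ d (≼⇒≤ (lca-≼ʳ x i))

    deeper : depth z < depth (lca x j)
    -- If `i` lies on the path from the root to `x`, so does its parent `j`, still strictly below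
    -- `z`; otherwise `lca x i` is a proper ancestor of `i`, hence an ancestor of `j`.
    deeper with lca x i Fin.≟ i
    ... | yes eq = <-≤-trans (≼-strict (≼-pred z≼i z≢i ji) (j≢z ∘ sym))
      (≼⇒≤ (lca-greatest (≼-trans (parent-≼ ji) (subst (_≼ x) eq (lca-≼ˡ x i))) ≼-refl))
    ... | no neq = <-≤-trans d
      (≼⇒≤ (lca-greatest (lca-≼ˡ x i) (≼-pred (lca-≼ʳ x i) neq ji)))

  between? : ∀ z x z₁ → Decidable (Between z x z₁)
  between? z x z₁ i = (depth z <? depth (lca x i)) ×-dec (z₁ ≼? i →-dec z₁ Fin.≟ i)

  Child : Fin m → Fin m → Pred (Fin m) 0ℓ
  Child z i a = Parent z a × a ≼ i

  child? : ∀ z i → Decidable (Child z i)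
  child? z i a = parent? z a ×-dec a ≼? i

  child-unique : ∀ {z i a b} → Child z i a → Child z i b → a ≡ b
  child-unique (za , a≼i) (zb , b≼i) =
    ≼-≥⇒≡ (≼-chain a≼i b≼i (≤-reflexive da≡db)) (≤-reflexive (sym da≡db))
    where da≡db = trans (sym (parent-depth za)) (parent-depth zb)

  child-towards : ∀ {z i} → z ≼ i → z ≢ i → ∃[ a ] Child z i a
  child-towards ≼-refl z≢i = ⊥-elim (z≢i refl)
  child-towards {z} (up {b} p r) _ with z Fin.≟ b
  ... | yes refl = _ , r , ≼-refl
  ... | no z≢b with a , za , a≼b ← child-towards p z≢b = a , za , up a≼b r

  -- The subtrees at those children of z whose index lies strictly between
  -- those of the children towards lo and hi; a delimiter that is not below z
  -- imposes nothing.
  Fan : (z lo hi : Fin m) → Pred (Fin m) 0ℓ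
  Fan z lo hi i = ∃[ a ] Child z i a ×
    (∀ b → Child z lo b → ¬ a Fin.≤ b) × (∀ b → Child z hi b → ¬ b Fin.≤ a)

  -- The only edge out of the subtree at a child of `z` leads up to `z`.
  fan-cut : ∀ {z lo hi} → Cut (Fan z lo hi) (_≡ z)
  fan-cut (a , (za , a≼i) , bounds) (inj₁ ij) = inj₂ (inj₁ (a , (za , up a≼i ij) , bounds))
  fan-cut {i = i} (a , (za , a≼i) , bounds) (inj₂ ji) with a Fin.≟ i
  ... | yes refl = inj₂ (inj₂ (parent-unique ji za))
  ... | no a≢i   = inj₂ (inj₁ (a , (za , ≼-pred a≼i a≢i ji) , bounds))

  fan? : ∀ z lo hi → Decidable (Fan z lo hi)
  fan? z lo hi i = Fin.any? λ a → child? z i a ×-dec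
    Fin.all? (λ b → child? z lo b →-dec ¬? (a Fin.≤? b)) ×-dec
    Fin.all? (λ b → child? z hi b →-dec ¬? (b Fin.≤? a))

  -- Locating a node relative to a marked set

  module _ {Y : Pred (Fin m) 0ℓ} (Y? : Decidable Y) (Y-root : Y root) where

    -- Among the children of `z` in `L` whose subtrees contain a node of `Y`, take the extremal one
    -- and let `y` be such a node below it. Extremality excludes all these children, and whatever
    -- lies beyond all of `L` lies beyond this one.
    delimiter : ∀ z {_⊑_ : Rel (Fin m) 0ℓ} {L : Pred (Fin m) 0ℓ} →
      B.Total _⊑_ → B.Transitive _⊑_ → Decidable L →
      ∃[ y ] Y y ×
        (∀ {a x} → Y x → Child z x a → L a → ¬ (∀ b → Child z y b → ¬ a ⊑ b)) ×
        (∀ a → (∀ b → L b → ¬ a ⊑ b) → ∀ b → Child z y b → ¬ a ⊑ b)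
    delimiter z total ⊑-trans L?
      with extremum total ⊑-trans
             (λ b → Fin.any? (λ x → Y? x ×-dec child? z x b) ×-dec L? b)
    ... | inj₁ (c , ((y , Yy , yc) , Lc) , best) =
      y , Yy ,
      (λ Yx xa La bounded → bounded c yc (best _ ((_ , Yx , xa) , La))) ,
      (λ a beyond b yb → beyond b (subst _ (child-unique yc yb) Lc))
    -- The root lies below no child of `z`, so as a delimiter it imposes nothing.
    ... | inj₂ none =
      root , Y-root ,
      (λ Yx xa La _ → none _ ((_ , Yx , xa) , La)) ,
      (λ a _ b (zb , b≼root) _ → n≮0 (<-≤-trans (parent-< zb)
        (≤-trans (≼⇒≤ b≼root) (≤-reflexive depth-root))))

    -- In both regions nodes of `Y` occur at most on the boundary, as `separates` requires. The
    -- condition `x₁ ≢ root` makes `x₁` the node of a sample point, so that a `just` entry can name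
    -- it and mark the kind of region.
    data Located (q : Fin m) : Set where
      between : ∀ {x₁ x₂ x₃ z z₁} → Y x₁ → Y x₂ → Y x₃ → x₁ ≢ root →
        z ≡ lca x₁ x₃ → z₁ ≡ lca x₁ x₂ → Between z x₁ z₁ q →
        (∀ {x} → Y x → Between z x₁ z₁ x → x ≡ z ⊎ x ≡ z₁) → Located q
      fan : ∀ {x₁ x₂ lo hi z} → Y x₁ → Y x₂ → Y lo → Y hi →
        z ≡ lca x₁ x₂ → Fan z lo hi q ⊎ q ≡ z →
        (∀ {x} → Y x → ¬ Fan z lo hi x) → Located q

    private
      module _ {q z y₁ y₂ : Fin m} (z≼q : z ≼ q) (Y₁ : Y y₁) (Y₂ : Y y₂) (z≡ : z ≡ lca y₁ y₂)
        (deepest : ∀ {x y} → Y x → Y y → lca x y ≼ q → depth (lca x y) ≤ depth z) where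

        z≼y₁ : z ≼ y₁
        z≼y₁ = subst (_≼ y₁) (sym z≡) (lca-≼ˡ y₁ y₂)

        z≼y₂ : z ≼ y₂
        z≼y₂ = subst (_≼ y₂) (sym z≡) (lca-≼ʳ y₁ y₂)

        -- Suppose `x` meets both `y₁` and `y₂` strictly below `z`. The two meeting points are
        -- ancestors of `x`, hence comparable, and the upper one would be a common ancestor of `y₁`
        -- and `y₂` deeper than their `lca`.
        meeting-at-z : ∀ {x} → z ≼ x → ∃[ y ] Y y × z ≡ lca x y
        meeting-at-z {x} z≼x
          with depth z <? depth (lca x y₁) | depth z <? depth (lca x y₂)
        ... | no ≮₁  | _      = y₁ , Y₁ , ≼-≥⇒≡ (lca-greatest z≼x z≼y₁) (≮⇒≥ ≮₁)
        ... | yes _  | no ≮₂  = y₂ , Y₂ , ≼-≥⇒≡ (lca-greatest z≼x z≼y₂) (≮⇒≥ ≮₂)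
        ... | yes <₁ | yes <₂ = ⊥-elim (<⇒≱ (proj₁ (proj₂ common))
          (≤-trans (≼⇒≤ (proj₂ (proj₂ common))) (≤-reflexive (cong depth (sym z≡)))))
          where
          common : ∃[ w ] depth z < depth w × w ≼ lca y₁ y₂
          common with ≤-total (depth (lca x y₁)) (depth (lca x y₂))
          ... | inj₁ le = _ , <₁ , lca-greatest (lca-≼ʳ _ _)
            (≼-trans (≼-chain (lca-≼ˡ _ _) (lca-≼ˡ _ _) le) (lca-≼ʳ _ _))
          ... | inj₂ ge = _ , <₂ , lca-greatest
            (≼-trans (≼-chain (lca-≼ˡ _ _) (lca-≼ˡ _ _) ge) (lca-≼ʳ _ _)) (lca-≼ʳ _ _)

        -- `z₁` is the highest point strictly below `z` at which a node of `Y`, possibly `x₁`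
        -- itself, meets `x₁`. It is no ancestor of `q`, because `z` is the deepest meeting point
        -- above `q`; a node of `Y` in the region is below `z₁` by minimality, hence equals it.
        locate-between : ∀ {x₁} → Y x₁ → depth z < depth (lca x₁ q) → Located q
        locate-between {x₁} Yx₁ d
          with argmin (λ x → Y? x ×-dec (depth z <? depth (lca x₁ x))) (λ x → depth (lca x₁ x))
             | meeting-at-z (≼-trans (≼-chain z≼q (lca-≼ʳ x₁ q) (<⇒≤ d)) (lca-≼ˡ x₁ q))
        ... | inj₂ none | _ = ⊥-elim (none x₁
          (Yx₁ , <-≤-trans d (≼⇒≤ (lca-greatest (lca-≼ˡ x₁ q) (lca-≼ˡ x₁ q)))))
        ... | inj₁ (x₂ , (Yx₂ , d₂) , best) | x₃ , Yx₃ , z≡′ =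
          between Yx₁ Yx₂ Yx₃ x₁≢root z≡′ refl
            (d , λ z₁≼q → ⊥-elim (<⇒≱ d₂ (deepest Yx₁ Yx₂ z₁≼q)))
            (λ {x} Yx (dx , below) → inj₂ (sym (below
              (≼-trans (≼-chain (lca-≼ˡ x₁ x₂) (lca-≼ˡ x₁ x) (best x (Yx , dx))) (lca-≼ʳ x₁ x)))))
          where
          x₁≢root : x₁ ≢ root
          x₁≢root refl = n≮0 (<-≤-trans d (≤-trans (≼⇒≤ (lca-≼ˡ x₁ q)) (≤-reflexive depth-root)))

        -- The subtree of `z` towards `q` contains no node of `Y`, so the nearest occupied children
        -- on both sides delimit a fan free of `Y`.
        locate-fan : (∀ {x} → Y x → ¬ depth z < depth (lca x q)) → Located q
        locate-fan shallow = finish side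
          where
          -- The index m, of no child, stands for q = z.
          Side : ℕ → Set
          Side j = (∃[ a ] Child z q a × toℕ a ≡ j) ⊎ q ≡ z × j ≡ m

          side : ∃ Side
          side with q Fin.≟ z
          ... | yes q≡z = m , inj₂ (q≡z , refl)
          ... | no  q≢z with a , za ← child-towards z≼q (q≢z ∘ sym) = toℕ a , inj₁ (a , za , refl)

          finish : ∃ Side → Located q
          finish (j , s)
            with delimiter z Fin.≤-total Fin.≤-trans (λ b → toℕ b <? j)
               | delimiter z (flip Fin.≤-total) (flip Fin.≤-trans) (λ b → j <? toℕ b)
          ... | lo , Ylo , lo-free , lo-ok | hi , Yhi , hi-free , hi-ok =
            fan Y₁ Y₂ Ylo Yhi z≡ (q-placed s) free
            where
            q-placed : Side j → Fan z lo hi q ⊎ q ≡ z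
            q-placed (inj₂ (q≡z , _))       = inj₂ q≡z
            q-placed (inj₁ (a , za , refl)) =
              inj₁ (a , za , lo-ok a (λ _ → <⇒≱) , hi-ok a (λ _ → <⇒≱))

            unoccupied : ∀ {x a} → Side j → Y x → Child z x a → toℕ a ≢ j
            unoccupied {a = a} (inj₂ (_ , refl)) _ _ eq = <⇒≢ (Fin.toℕ<n a) eq
            unoccupied (inj₁ (b , (zb , b≼q) , refl)) Yx (za , a≼x) eq
              with refl ← Fin.toℕ-injective eq =
              shallow Yx (<-≤-trans (parent-< za) (≼⇒≤ (lca-greatest a≼x b≼q)))

            free : ∀ {x} → Y x → ¬ Fan z lo hi x
            free Yx (a , xa , above , below) with <-cmp (toℕ a) j
            ... | B.tri< a<j _ _ = lo-free Yx xa a<j above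
            ... | B.tri≈ _ a≡j _ = unoccupied s Yx xa a≡j
            ... | B.tri> _ _ j<a = hi-free Yx xa j<a below

    -- `z` is the deepest ancestor of `q` at which two nodes of `Y` meet. The kind of region depends
    -- on whether some node of `Y` meets `q` strictly below `z`.
    locate : ∀ q → Located q
    locate q with argmax
      (λ z → z ≼? q ×-dec Fin.any? λ y₁ → Fin.any? λ y₂ →
             Y? y₁ ×-dec Y? y₂ ×-dec (z Fin.≟ lca y₁ y₂))
      depth
    ... | inj₂ none = ⊥-elim (none (lca root root)
      (≼-trans (lca-≼ˡ root root) (root≼ q) , root , root , Y-root , Y-root , refl))
    ... | inj₁ (z , (z≼q , y₁ , y₂ , Y₁ , Y₂ , z≡) , best)
      with Fin.any? (λ x → Y? x ×-dec (depth z <? depth (lca x q)))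
    ...   | yes (x , Yx , d) = locate-between z≼q Y₁ Y₂ z≡
              (λ Yx Yy p → best _ (p , _ , _ , Yx , Yy , refl)) Yx d
    ...   | no none = locate-fan z≼q Y₁ Y₂ z≡
              (λ Yx Yy p → best _ (p , _ , _ , Yx , Yy , refl)) (λ Yx d → none (_ , Yx , d))

-- Tree decompositions

elements : Subset n → List (Fin n)
elements []            = []
elements (outside ∷ S) = List.map suc (elements S)
elements (inside  ∷ S) = zero ∷ List.map suc (elements S)

length-elements : ∀ (S : Subset n) → length (elements S) ≡ ∣ S ∣
length-elements []            = refl
length-elements (outside ∷ S) = trans (length-map suc (elements S)) (length-elements S)
length-elements (inside  ∷ S) = cong suc (trans (length-map suc (elements S)) (length-elements S))

∈-elements : ∀ {S : Subset n} {v} → v ∈ S → v ∈ˡ elements S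
∈-elements {S = inside  ∷ S} here        = here refl
∈-elements {S = outside ∷ S} (there v∈S) = ∈-map⁺ suc (∈-elements v∈S)
∈-elements {S = inside  ∷ S} (there v∈S) = there (∈-map⁺ suc (∈-elements v∈S))

padRight : ∀ {A : Set} → A → ∀ K → List A → Vec A K
padRight d zero    _        = []
padRight d (suc K) []       = d ∷ padRight d K []
padRight d (suc K) (x ∷ xs) = x ∷ padRight d K xs

∈-padRight : ∀ {A : Set} {d x : A} {K xs} → length xs ≤ K → x ∈ˡ xs → x ∈ᵛ padRight d K xs
∈-padRight (s≤s le) (here refl) = here refl
∈-padRight (s≤s le) (there x∈)  = there (∈-padRight le x∈)

≤-maximum : ∀ {m} (f : Fin m → ℕ) i → f i ≤ Fun.foldr _⊔_ 0 f
≤-maximum f zero    = m≤m⊔n _ _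
≤-maximum f (suc i) = ≤-trans (≤-maximum (f ∘ suc) i) (m≤n⊔m _ _)

module Separation {n} {G : Graph n} (D : TreeDecomposition G) where
  open TreeDecomposition D renaming (m to N)
  open Rooting T isTree using (rooted; edge⇒parent)
  open RootedTreeProperties rooted
  open Distance G

  bag-size : ∀ {t} → width ≤ t → ∀ i → ∣ bag i ∣ ≤ suc t
  bag-size w≤t i = ≤-trans (≤-maximum (λ i → ∣ bag i ∣) i)
    (≤-trans (m≤n+m∸n _ 1) (s≤s w≤t))

  node : Fin n → Fin N
  node v = proj₁ (coversVertices v)

  InBag : Pred (Fin N) 0ℓ → Pred (Fin n) 0ℓ
  InBag Z v = ∃[ z ] Z z × v ∈ bag z

  module _ {R Z : Pred (Fin N) 0ℓ} (cut : Cut R Z) where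

    -- Every node on the walk has `v` in its bag, so `v` lies in a bag of `Z` as soon as the walk
    -- meets `Z`.
    carry : ∀ {v i j l} → R i → Walk (AdjAt v) i j l → InBag Z v ⊎ R j
    carry Ri []                  = inj₂ Ri
    carry Ri ((vi , vj , e) ∷ p) with cut Ri (edge⇒parent e)
    ... | inj₁ Zi        = inj₁ (_ , Zi , vi)
    ... | inj₂ (inj₁ Rj) = carry Rj p
    ... | inj₂ (inj₂ Zj) = inj₁ (_ , Zj , vj)

    Crossing : Fin n → Fin n → ℕ → Set
    Crossing v x l = ∃[ b ] InBag Z b ×
      ∃[ l₁ ] ∃[ l₂ ] l₁ + l₂ ≡ l × Walk (Adj G) v b l₁ × Walk (Adj G) b x l₂

    -- Consecutive vertices share a bag. Moving to it among the nodes of the current vertex either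
    -- meets `Z`, which makes this vertex the crossing point, or gives a node of `R` for the next
    -- vertex. At `x` the move goes to `node x`, where `out` applies.
    crossing : ∀ {v x l i} → (R (node x) → Z (node x)) → R i → v ∈ bag i →
      Walk (Adj G) v x l → Crossing v x l
    crossing {v} out Ri v∈i []
      with carry Ri (proj₂ (connectedAt v v∈i (proj₂ (coversVertices v))))
    ... | inj₁ v∈Z = v , v∈Z , _ , _ , refl , [] , []
    ... | inj₂ Rv  = v , (_ , out Rv , proj₂ (coversVertices v)) , _ , _ , refl , [] , []
    crossing {v} out Ri v∈i (e ∷ p) with coversEdges e
    ... | j , v∈j , u∈j with carry Ri (proj₂ (connectedAt v v∈i v∈j))
    ...   | inj₁ v∈Z = v , v∈Z , _ , _ , refl , [] , e ∷ p
    ...   | inj₂ Rj with crossing out Rj u∈j p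
    ...     | b , b∈Z , _ , _ , refl , p₁ , p₂ = b , b∈Z , _ , _ , refl , e ∷ p₁ , p₂

    -- A shortest walk is cut at its crossing point, which is `c` itself if `node c` lies in `Z`.
    separates : ∀ {c x} → R (node c) ⊎ Z (node c) → (R (node x) → Z (node x)) →
      dist c x < n → ∃[ b ] InBag Z b × dist c b + dist b x ≤ dist c x
    separates {c} {x} c-in out finite = measure (cross c-in)
      where
      p = dist-walk finite

      cross : R (node c) ⊎ Z (node c) → Crossing c x (dist c x)
      cross (inj₁ Rc) = crossing out Rc (proj₂ (coversVertices c)) p
      cross (inj₂ Zc) = c , (_ , Zc , proj₂ (coversVertices c)) , _ , _ , refl , [] , p

      measure : Crossing c x (dist c x) → ∃[ b ] InBag Z b × dist c b + dist b x ≤ dist c x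
      measure (b , b∈Z , _ , _ , eq , p₁ , p₂) =
        b , b∈Z , ≤-trans (+-mono-≤ (dist≤walk p₁) (dist≤walk p₂)) (≤-reflexive eq)

-- Compression relative to a separator

collect : ∀ {A : Set} {L} {B : Fin L → A → Set} → (∀ k → ∃ (B k)) →
  Σ[ xs ∈ Vec A L ] ∀ k → B k (Vec.lookup xs k)
collect {B = B} f = Vec.tabulate (proj₁ ∘ f) ,
  λ k → subst (B k) (sym (Vec.lookup∘tabulate (proj₁ ∘ f) k)) (proj₂ (f k))

-- Balls with strict radii

module Balls {n} (G : Graph n) where
  open Distance G

  -- Truncating at `n` excludes the vertices at infinite distance.
  inBall⇔ : ∀ {c v} r → InBall G c (+ r) v ⇔ dist c v < n ⊓ suc r
  inBall⇔ {c} {v} r = mk⇔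
    (λ { (d , (p , _) , +≤+ d≤r) → ⊓-pres-m< (dist-finite p) (s≤s (≤-trans (dist≤walk p) d≤r)) })
    (λ d< → dist c v , (dist-walk (m<n⊓o⇒m<n n _ d<) , λ {_} → dist≤walk) ,
            +≤+ (s≤s⁻¹ (m<n⊓o⇒m<o n _ d<)))

  -- With strict radii the empty ball is the case `r = 0`, and the radii up to `n` give all balls.
  strictBall : Fin n → ℕ → Subset n
  strictBall c r = Vec.tabulate λ v → does (dist c v <? r)

  ∈-strictBall⁺ : ∀ {c r v} → dist c v < r → v ∈ strictBall c r
  ∈-strictBall⁺ {c} {r} {v} d< = Vec.lookup⇒[]= v _
    (trans (Vec.lookup∘tabulate _ v) (dec-true (dist c v <? r) d<))

  ∈-strictBall⁻ : ∀ {c r v} → v ∈ strictBall c r → dist c v < r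
  ∈-strictBall⁻ {c} {r} {v} v∈ = <ᵇ⇒< (dist c v) r (subst Bool.T
    (trans (sym (Vec.[]=⇒lookup v∈)) (Vec.lookup∘tabulate _ v)) _)

  strictBall-isEdge : ∀ c {r} → r ≤ n → Hypergraph.IsEdge (balls G) (strictBall c r)
  strictBall-isEdge c {zero}  _   = c , -[1+ 0 ] , λ v →
    mk⇔ (λ v∈ → ⊥-elim (n≮0 (∈-strictBall⁻ {c} v∈))) (λ { (_ , _ , ()) })
  strictBall-isEdge c {suc r} r<n = c , + r , λ v → mk⇔
    (λ v∈ → Equivalence.from (inBall⇔ r) (subst (dist c v <_) (sym n⊓r) (∈-strictBall⁻ {c} v∈)))
    (λ b → ∈-strictBall⁺ (subst (dist c v <_) n⊓r (Equivalence.to (inBall⇔ r) b)))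
    where
    n⊓r : n ⊓ suc r ≡ suc r
    n⊓r = m≥n⇒m⊓n≡n r<n

  Fits : Subset n → Subset n → Fin n → ℕ → Set
  Fits X⁺ X⁻ c r = (∀ x → x ∈ X⁺ → dist c x < r) × (∀ y → y ∈ X⁻ → r ≤ dist c y)

  fits⇒realizes : ∀ {X⁺ X⁻ c r} → Fits X⁺ X⁻ c r → Realizes (strictBall c r) X⁺ X⁻
  fits⇒realizes {X⁺} {X⁻} {c} {r} (pos , neg) =
    (λ x∈ → ∈-strictBall⁺ (pos _ x∈)) ,
    λ (y , y∈) → let y∈S , y∈X⁻ = Subset.x∈p∩q⁻ (strictBall c r) X⁻ y∈ in
      <⇒≱ (∈-strictBall⁻ {c} y∈S) (neg y y∈X⁻)

  Center : Set
  Center = Fin n × Fin (suc n)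

  FitsCenter : Subset n → Subset n → Center → Set
  FitsCenter X⁺ X⁻ (c , r) = Fits X⁺ X⁻ c (toℕ r)

  center? : {P : Center → Set} → (∀ c r → Dec (P (c , r))) → Dec (∃ P)
  center? P? = map′ (λ (c , r , p) → (c , r) , p) (λ ((c , r) , p) → c , r , p)
    (Fin.any? λ c → Fin.any? λ r → P? c r)

  fits? : ∀ X⁺ X⁻ → Dec (∃ (FitsCenter X⁺ X⁻))
  fits? X⁺ X⁻ = center? λ c r →
    Fin.all? (λ x → x Subset.∈? X⁺ →-dec (dist c x <? toℕ r)) ×-dec
    Fin.all? (λ y → y Subset.∈? X⁻ →-dec (toℕ r ≤? dist c y))

  traced⇒fits : ∀ {X⁺ X⁻} →
    ∃[ e ] Hypergraph.IsEdge (balls G) e × X⁺ ⊆ e × Empty (X⁻ ∩ e) → ∃ (FitsCenter X⁺ X⁻)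
  traced⇒fits {X⁺} {X⁻} (e , (c , r , e⇔) , X⁺⊆e , disjoint) =
    let s , s≤n , ball⇔ = radius r in
    (c , Fin.fromℕ< (s≤s s≤n)) ,
    subst (Fits X⁺ X⁻ c) (sym (Fin.toℕ-fromℕ< (s≤s s≤n)))
      ( (λ x x∈ → Equivalence.to (ball⇔ x) (Equivalence.to (e⇔ x) (X⁺⊆e x∈)))
      , (λ y y∈ → ≮⇒≥ λ d< → disjoint
          (y , Subset.x∈p∩q⁺ (y∈ , Equivalence.from (e⇔ y) (Equivalence.from (ball⇔ y) d<)))) )
    where
    radius : ∀ r → ∃[ s ] s ≤ n × (∀ v → InBall G c r v ⇔ dist c v < s)
    radius (+ r)    = n ⊓ suc r , m⊓n≤m n _ , λ v → inBall⇔ r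
    radius -[1+ _ ] = 0 , z≤n , λ v → mk⇔ (λ { (_ , _ , ()) }) (λ ())

  -- What the decoder knows: the centre lies in a given region, which the
  -- vertices e separate from the sample, and for each k the farthest positive
  -- point reached through e k and the nearest negative point.
  record Spec : Set₁ where
    field
      Allowed  : Pred (Fin n) 0ℓ
      allowed? : Decidable Allowed
      {L}      : ℕ
      e        : Vec (Fin n) L
      P Q      : Vec (Maybe (Fin n)) L

  via : Fin n → Fin n → Fin n → ℕ
  via c b x = dist c b + dist b x

  Satisfies : Spec → Fin n → ℕ → Set
  Satisfies s c r = Allowed c × ∀ k →
    Maybe.All (λ x → via c (Vec.lookup e k) x < r) (Vec.lookup P k) ×
    Maybe.All (λ y → r ≤ via c (Vec.lookup e k) y) (Vec.lookup Q k)
    where open Spec s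

  satisfies? : ∀ s c r → Dec (Satisfies s c r)
  satisfies? s c r = allowed? c ×-dec Fin.all? λ k →
    Maybe.dec (λ x → via c (Vec.lookup e k) x <? r) (Vec.lookup P k) ×-dec
    Maybe.dec (λ y → r ≤? via c (Vec.lookup e k) y) (Vec.lookup Q k)
    where open Spec s

  opaque
    -- The fallback keeps the decoder proper on arrays that encode no sample.
    solve : Fin n → Spec → Center
    solve c₀ s with center? (λ c r → satisfies? s c (toℕ r))
    ... | yes (cr , _) = cr
    ... | no _         = c₀ , zero

    solve-satisfies : ∀ c₀ s {c r} → Satisfies s c (toℕ {suc n} r) →
      Satisfies s (proj₁ (solve c₀ s)) (toℕ (proj₂ (solve c₀ s)))
    solve-satisfies c₀ s sat with center? (λ c r → satisfies? s c (toℕ r))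
    ... | yes (_ , p) = p
    ... | no none     = ⊥-elim (none (_ , sat))

  -- Points are compared by `dist b` alone, which does not involve `c`, so the comparison stays
  -- valid for the centre found by the decoder.
  Farthest : Subset n → Fin n → ℕ → Fin n → Maybe (Fin n) → Set
  Farthest X c r b p = Maybe.All (_∈ X) p × Maybe.All (λ x → via c b x < r) p ×
    (∀ x → x ∈ X → via c b x < r → MaybeAny.Any (λ x* → dist b x ≤ dist b x*) p)

  farthest : ∀ X c r b → ∃ (Farthest X c r b)
  farthest X c r b with argmax (λ x → x Subset.∈? X ×-dec (via c b x <? r)) (dist b)
  ... | inj₁ (x* , (x*∈ , near) , best) =
    just x* , just x*∈ , just near , λ x x∈ near → just (best x (x∈ , near))
  ... | inj₂ none = nothing , nothing , nothing , λ x x∈ near → ⊥-elim (none x (x∈ , near))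

  Nearest : Subset n → Fin n → Maybe (Fin n) → Set
  Nearest X b q = Maybe.All (_∈ X) q ×
    (∀ y → y ∈ X → MaybeAny.Any (λ y* → dist b y* ≤ dist b y) q)

  nearest : ∀ X b → ∃ (Nearest X b)
  nearest X b with argmin (Subset._∈? X) (dist b)
  ... | inj₁ (y* , y*∈ , best) = just y* , just y*∈ , λ y y∈ → just (best y y∈)
  ... | inj₂ none              = nothing , nothing , λ y y∈ → ⊥-elim (none y y∈)

  module Decoding (s : Spec) where
    open Spec s

    module _ {X⁺ X⁻ : Subset n} {c : Fin n} {r : ℕ}
      (r≤n : r ≤ n) (fits : Fits X⁺ X⁻ c r) (c-allowed : Allowed c)
      (separated : ∀ {c x} → Allowed c → x ∈ X⁺ ∪ X⁻ → dist c x < n →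
        ∃[ b ] b ∈ᵛ e × via c b x ≤ dist c x)
      (P-farthest : ∀ k → Farthest X⁺ c r (Vec.lookup e k) (Vec.lookup P k))
      (Q-nearest : ∀ k → Nearest X⁻ (Vec.lookup e k) (Vec.lookup Q k))
      where

      -- The negative bounds follow from the triangle inequality, whichever vertex `e k` is; padding
      -- a bag with an arbitrary vertex is therefore harmless.
      spec-satisfied : Satisfies s c r
      spec-satisfied = c-allowed , λ k →
        proj₁ (proj₂ (P-farthest k)) ,
        Maybe.map (λ y∈ → ≤-trans (proj₂ fits _ y∈) (dist-triangle c _ _)) (proj₁ (Q-nearest k))

      separated-at : ∀ {c x} → Allowed c → x ∈ X⁺ ∪ X⁻ → dist c x < n →
        ∃[ k ] via c (Vec.lookup e k) x ≤ dist c x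
      separated-at ac x∈ d< with b , b∈e , le ← separated ac x∈ d< =
        Anyᵛ.index b∈e , subst (λ b → via _ b _ ≤ _) (AnyᵛP.lookup-index b∈e) le

      -- Positive points are separated from the original centre `c`: each is reached through some
      -- `e k`, and the stored point at least as far from `e k` bounds its distance from `c′`.
      -- Negative points are separated from `c′`: one inside the new ball would be reached through
      -- some `e k`, and the stored point nearest to `e k` forbids this. Hence separation is assumed
      -- for every allowed centre.
      satisfies⇒fits : ∀ {c′ r′} → r′ ≤ n → Satisfies s c′ r′ → Fits X⁺ X⁻ c′ r′
      satisfies⇒fits {c′} {r′} r′≤n (ac′ , sat) = pos , λ y y∈ → ≮⇒≥ (neg y y∈)
        where
        pos : ∀ x → x ∈ X⁺ → dist c′ x < r′
        pos x x∈ with d< ← proj₁ fits x x∈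
          with k , le ← separated-at c-allowed (Subset.p⊆p∪q X⁻ x∈) (<-≤-trans d< r≤n)
          with Vec.lookup P k | proj₁ (sat k) | proj₂ (proj₂ (P-farthest k)) x x∈ (≤-<-trans le d<)
        ... | just x* | just near | just far = begin-strict
          dist c′ x                      ≤⟨ dist-triangle c′ (Vec.lookup e k) x ⟩
          via c′ (Vec.lookup e k) x      ≤⟨ +-monoʳ-≤ (dist c′ (Vec.lookup e k)) far ⟩
          via c′ (Vec.lookup e k) x*     <⟨ near ⟩
          r′                             ∎
          where open ≤-Reasoning

        neg : ∀ y → y ∈ X⁻ → ¬ dist c′ y < r′
        neg y y∈ d<
          with k , le ← separated-at ac′ (Subset.q⊆p∪q X⁺ X⁻ y∈) (<-≤-trans d< r′≤n)
          with Vec.lookup Q k | proj₂ (sat k) | proj₂ (Q-nearest k) y y∈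
        ... | just y* | just far | just near = <⇒≱ d< (begin
          r′                             ≤⟨ far ⟩
          via c′ (Vec.lookup e k) y*     ≤⟨ +-monoʳ-≤ (dist c′ (Vec.lookup e k)) near ⟩
          via c′ (Vec.lookup e k) y      ≤⟨ le ⟩
          dist c′ y                      ∎)
          where open ≤-Reasoning

-- The compression scheme

record Code (A : Set) (K : ℕ) : Set where
  constructor code
  field
    a₀ a₁ a₂    : A
    p₁ p₂ q₁ q₂ : Vec A K

module _ {A : Set} {K : ℕ} where

  write : Code A K → Vec A (3 + ((K + K) + (K + K)))
  write (code a₀ a₁ a₂ p₁ p₂ q₁ q₂) = a₀ ∷ a₁ ∷ a₂ ∷ ((p₁ ++ p₂) ++ (q₁ ++ q₂))

  read : Vec A (3 + ((K + K) + (K + K))) → Code A K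
  read (a₀ ∷ a₁ ∷ a₂ ∷ v) = code a₀ a₁ a₂
    (Vec.take K (Vec.take (K + K) v)) (Vec.drop K (Vec.take (K + K) v))
    (Vec.take K (Vec.drop (K + K) v)) (Vec.drop K (Vec.drop (K + K) v))

  take-++ : ∀ m {k} (xs : Vec A m) (ys : Vec A k) → Vec.take m (xs ++ ys) ≡ xs
  take-++ m xs ys = Vec.++-injectiveˡ _ _ (Vec.take++drop≡id m (xs ++ ys))

  drop-++ : ∀ m {k} (xs : Vec A m) (ys : Vec A k) → Vec.drop m (xs ++ ys) ≡ ys
  drop-++ m xs ys = Vec.++-injectiveʳ _ xs (Vec.take++drop≡id m (xs ++ ys))

  read-write : ∀ c → read (write c) ≡ c
  read-write (code _ _ _ p₁ p₂ q₁ q₂)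
    rewrite take-++ (K + K) (p₁ ++ p₂) (q₁ ++ q₂) | drop-++ (K + K) (p₁ ++ p₂) (q₁ ++ q₂)
          | take-++ K p₁ p₂ | drop-++ K p₁ p₂ | take-++ K q₁ q₂ | drop-++ K q₁ q₂ = refl

module Scheme {n t} {G : Graph n} (c₀ : Fin n)
  (D : TreeDecomposition G) (width≤t : TreeDecomposition.width D ≤ t) where
  open TreeDecomposition D using (T; isTree; bag; coversVertices) renaming (m to N)
  open Rooting T isTree using (rooted)
  open RootedTreeProperties rooted
  open Separation D
  open Balls G
  open Distance G

  K : ℕ
  K = suc t

  bagVec : Fin N → Vec (Fin n) K
  bagVec z = padRight c₀ K (elements (bag z))

  ∈-bagVec : ∀ {z v} → v ∈ bag z → v ∈ᵛ bagVec z
  ∈-bagVec {z} v∈z = ∈-padRight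
    (≤-trans (≤-reflexive (length-elements (bag z))) (bag-size width≤t z)) (∈-elements v∈z)

  -- The empty symbol names the root, which is marked without being the node of a sample point.
  node⊥ : Maybe (Fin n) → Fin N
  node⊥ nothing  = root
  node⊥ (just v) = node v

  -- The first entry tells the two kinds of region apart. A fan has only one
  -- separating bag, which leaves p₂ and q₂ free to hold its delimiters.
  spec : Code (Maybe (Fin n)) K → Spec
  spec (code nothing a₁ a₂ p₁ p₂ q₁ q₂) = record
    { Allowed  = λ c → Fan z lo hi (node c) ⊎ node c ≡ z
    ; allowed? = λ c → fan? z lo hi (node c) ⊎-dec node c Fin.≟ z
    ; e = bagVec z
    ; P = p₁
    ; Q = q₁
    }
    where
    z  = lca (node⊥ a₁) (node⊥ a₂)
    lo = node⊥ (Vec.head p₂)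
    hi = node⊥ (Vec.head q₂)
  spec (code (just x) a₁ a₂ p₁ p₂ q₁ q₂) = record
    { Allowed  = λ c → Between z (node x) z₁ (node c)
    ; allowed? = λ c → between? z (node x) z₁ (node c)
    ; e = bagVec z ++ bagVec z₁
    ; P = p₁ ++ p₂
    ; Q = q₁ ++ q₂
    }
    where
    z₁ = lca (node x) (node⊥ a₁)
    z  = lca (node x) (node⊥ a₂)

  decode : Code (Maybe (Fin n)) K → Center
  decode κ = solve c₀ (spec κ)

  module _ (X⁺ X⁻ : Subset n) where

    Entry : Pred (Maybe (Fin n)) 0ℓ
    Entry = Maybe.All (_∈ X⁺ ∪ X⁻)

    Marked : Pred (Fin N) 0ℓ
    Marked i = i ≡ root ⊎ ∃[ x ] x ∈ X⁺ ∪ X⁻ × node x ≡ i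

    marked? : Decidable Marked
    marked? i = i Fin.≟ root ⊎-dec
      Fin.any? (λ x → x Subset.∈? (X⁺ ∪ X⁻) ×-dec node x Fin.≟ i)

    entry : ∀ {i} → Marked i → ∃[ a ] Entry a × node⊥ a ≡ i
    entry (inj₁ refl)            = nothing , nothing , refl
    entry (inj₂ (x , x∈ , refl)) = just x , just x∈ , refl

    marked : ∀ {x} → x ∈ X⁺ ∪ X⁻ → Marked (node x)
    marked x∈ = inj₂ (_ , x∈ , refl)

    Encoded : Set
    Encoded = Σ[ κ ∈ Code (Maybe (Fin n)) K ] Allᵛ Entry (write κ) × FitsCenter X⁺ X⁻ (decode κ)

    module _ {c : Fin n} {r : Fin (suc n)} (fits : Fits X⁺ X⁻ c (toℕ r)) where

      private
        r≤n : ∀ {r : Fin (suc n)} → toℕ r ≤ n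
        r≤n {r} = s≤s⁻¹ (Fin.toℕ<n r)

        farthestᵛ : ∀ {L} (e : Vec (Fin n) L) → Σ[ P ∈ Vec (Maybe (Fin n)) L ]
          ∀ k → Farthest X⁺ c (toℕ r) (Vec.lookup e k) (Vec.lookup P k)
        farthestᵛ e = collect λ k → farthest X⁺ c (toℕ r) (Vec.lookup e k)

        nearestᵛ : ∀ {L} (e : Vec (Fin n) L) → Σ[ Q ∈ Vec (Maybe (Fin n)) L ]
          ∀ k → Nearest X⁻ (Vec.lookup e k) (Vec.lookup Q k)
        nearestᵛ e = collect λ k → nearest X⁻ (Vec.lookup e k)

        entries⁺ : ∀ {L} (e : Vec (Fin n) L) P →
          (∀ k → Farthest X⁺ c (toℕ r) (Vec.lookup e k) (Vec.lookup P k)) → Allᵛ Entry P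
        entries⁺ _ _ far = Allᵛ.lookup⁻ λ k → Maybe.map (Subset.p⊆p∪q X⁻) (proj₁ (far k))

        entries⁻ : ∀ {L} (e : Vec (Fin n) L) Q →
          (∀ k → Nearest X⁻ (Vec.lookup e k) (Vec.lookup Q k)) → Allᵛ Entry Q
        entries⁻ _ _ near = Allᵛ.lookup⁻ λ k → Maybe.map (Subset.q⊆p∪q X⁺ X⁻) (proj₁ (near k))

        decoded : ∀ κ → Spec.Allowed (spec κ) c →
          (∀ {c x} → Spec.Allowed (spec κ) c → x ∈ X⁺ ∪ X⁻ → dist c x < n →
            ∃[ b ] b ∈ᵛ Spec.e (spec κ) × via c b x ≤ dist c x) →
          (∀ k → Farthest X⁺ c (toℕ r) (Vec.lookup (Spec.e (spec κ)) k)
                                       (Vec.lookup (Spec.P (spec κ)) k)) →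
          (∀ k → Nearest X⁻ (Vec.lookup (Spec.e (spec κ)) k) (Vec.lookup (Spec.Q (spec κ)) k)) →
          FitsCenter X⁺ X⁻ (decode κ)
        decoded κ ac sep far near =
          satisfies⇒fits r≤n fits ac sep far near r≤n
            (solve-satisfies c₀ (spec κ) {r = r} (spec-satisfied r≤n fits ac sep far near))
          where open Decoding (spec κ)

      encode-fan : ∀ {a₁ a₂ lo hi z} → Entry a₁ → Entry a₂ → Entry lo → Entry hi →
        z ≡ lca (node⊥ a₁) (node⊥ a₂) →
        Fan z (node⊥ lo) (node⊥ hi) (node c) ⊎ node c ≡ z →
        (∀ {i} → Marked i → ¬ Fan z (node⊥ lo) (node⊥ hi) i) → Encoded
      encode-fan {a₁} {a₂} {lo} {hi} {z} E₁ E₂ Elo Ehi refl c-in free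
        with P , far ← farthestᵛ (bagVec z) | Q , near ← nearestᵛ (bagVec z) =
        κ ,
        nothing ∷ E₁ ∷ E₂ ∷ Allᵛ.++⁺
          (Allᵛ.++⁺ (entries⁺ (bagVec z) P far) (constant Elo))
          (Allᵛ.++⁺ (entries⁻ (bagVec z) Q near) (constant Ehi)) ,
        decoded κ c-in separated far near
        where
        constant : ∀ {a L} → Entry a → Allᵛ Entry (Vec.replicate L a)
        constant {L = zero}  _ = []
        constant {L = suc _} E = E ∷ constant E

        -- Only the heads of the two constant blocks are read.
        κ = code nothing a₁ a₂ P (Vec.replicate K lo) Q (Vec.replicate K hi)

        separated : ∀ {c x} → Fan z (node⊥ lo) (node⊥ hi) (node c) ⊎ node c ≡ z →
          x ∈ X⁺ ∪ X⁻ → dist c x < n → ∃[ b ] b ∈ᵛ bagVec z × via c b x ≤ dist c x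
        separated c-in x∈ d< with separates fan-cut c-in (⊥-elim ∘ free (marked x∈)) d<
        ... | b , (_ , refl , b∈z) , le = b , ∈-bagVec b∈z , le

      encode-between : ∀ {x a₁ a₂ z z₁} → x ∈ X⁺ ∪ X⁻ → Entry a₁ → Entry a₂ →
        z ≡ lca (node x) (node⊥ a₂) → z₁ ≡ lca (node x) (node⊥ a₁) →
        Between z (node x) z₁ (node c) →
        (∀ {i} → Marked i → Between z (node x) z₁ i → i ≡ z ⊎ i ≡ z₁) → Encoded
      encode-between {x} {a₁} {a₂} {z} {z₁} x∈ E₁ E₂ refl refl c-in out
        with P , far ← farthestᵛ (bagVec z ++ bagVec z₁)
           | Q , near ← nearestᵛ (bagVec z ++ bagVec z₁)
        with p₁ , p₂ , refl ← Vec.splitAt K P | q₁ , q₂ , refl ← Vec.splitAt K Q =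
        κ ,
        just x∈ ∷ E₁ ∷ E₂ ∷ Allᵛ.++⁺
          (entries⁺ bags (p₁ ++ p₂) far) (entries⁻ bags (q₁ ++ q₂) near) ,
        decoded κ c-in separated far near
        where
        bags = bagVec z ++ bagVec z₁
        κ = code (just x) a₁ a₂ p₁ p₂ q₁ q₂

        separated : ∀ {c y} → Between z (node x) z₁ (node c) →
          y ∈ X⁺ ∪ X⁻ → dist c y < n →
          ∃[ b ] b ∈ᵛ bagVec z ++ bagVec z₁ × via c b y ≤ dist c y
        separated c-in y∈ d<
          with separates (between-cut (lca-≼ˡ (node x) (node⊥ a₂))) (inj₁ c-in) (out (marked y∈)) d<
        ... | b , (_ , inj₁ refl , b∈z) , le = b , ∈-++⁺ˡ (∈-bagVec b∈z) , le
        ... | b , (_ , inj₂ refl , b∈z) , le = b , ∈-++⁺ʳ (bagVec z) (∈-bagVec b∈z) , le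

      encode : Encoded
      encode with locate marked? (inj₁ refl) (node c)
      -- The first entry must be `just x` here, so `x₁` has to come from a sample point.
      ... | between (inj₁ x≡root) _ _ x≢root _ _ _ _ = ⊥-elim (x≢root x≡root)
      ... | between (inj₂ (_ , x∈ , refl)) Y₂ Y₃ _ z≡ z₁≡ c-in out
        with _ , E₁ , refl ← entry Y₂ | _ , E₂ , refl ← entry Y₃ =
        encode-between x∈ E₁ E₂ z≡ z₁≡ c-in out
      encode | fan Y₁ Y₂ Ylo Yhi z≡ c-in free
        with _ , E₁ , refl ← entry Y₁ | _ , E₂ , refl ← entry Y₂
           | _ , Elo , refl ← entry Ylo | _ , Ehi , refl ← entry Yhi =
        encode-fan E₁ E₂ Elo Ehi z≡ c-in free

  -- The witness in `traced` is irrelevant, so centre and radius come from a finite search whose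
  -- success `traced` guarantees.
  recovered : (s : Sample (balls G)) → ∃ (FitsCenter (Sample.X⁺ s) (Sample.X⁻ s))
  recovered (sample X⁺ X⁻ traced) = recompute (fits? X⁺ X⁻) (traced⇒fits traced)

  encoded : (s : Sample (balls G)) → Encoded (Sample.X⁺ s) (Sample.X⁻ s)
  encoded s = encode _ _ {r = proj₂ (proj₁ (recovered s))} (proj₂ (recovered s))

  ball : Center → Subset n
  ball (c , r) = strictBall c (toℕ r)

  scheme : Σ[ C ∈ ArrayCompressionScheme (balls G) (3 + ((K + K) + (K + K))) ] Proper C
  scheme = record
    { κ          = λ s → write (proj₁ (encoded s))
    ; ρ          = λ v → ball (decode (read v))
    ; κ-within   = λ s → proj₁ (proj₂ (encoded s))
    ; ρ-realizes = λ s → subst (λ κ → Realizes (ball (decode κ)) _ _)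
        (sym (read-write (proj₁ (encoded s)))) (fits⇒realizes (proj₂ (proj₂ (encoded s))))
    } , λ v → strictBall-isEdge _ (s≤s⁻¹ (Fin.toℕ<n (proj₂ (decode (read v)))))

theorem2p1 : (t : ℕ) → .{{_ : NonZero t}} →
    (n : ℕ) → .{{_ : NonZero n}} → (G : Graph n) →
    (w : ℕ) → IsTreewidth G w → w ≤ t →
    Σ[ C ∈ ArrayCompressionScheme (balls G) (4 * t + 7) ] Proper C
theorem2p1 t (suc n) G w ((D , refl) , _) w≤t =
  subst (λ k → Σ[ C ∈ ArrayCompressionScheme (balls G) k ] Proper C)
    (size t) (Scheme.scheme zero D w≤t)
  where
  size : ∀ t → 3 + ((suc t + suc t) + (suc t + suc t)) ≡ 4 * t + 7
  size = solve-∀
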